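{- Let $G$ be a nontrivial traceable graph of order $n$ and let $\ell\geq 1$ be an integer. Then $pc_{1,\ell}(P_\alpha(G))\leq \ell+1$ for each permutation $\alpha$ of $[n]=\{1,2,\dots,n\}$.
   Context: All graphs are finite, undirected and simple; a graph is nontrivial if it has at least two vertices, and traceable if it contains a Hamiltonian path. Let $G$ have $V(G)=\{v_1,\dots,v_n\}$, let $\alpha$ be a permutation of $[n]$, and let $G'$ be a (disjoint) copy of $G$ with vertices $u_1,\dots,u_n$, where $u_i$ corresponds to $v_i$. The permutation graph $P_\alpha(G)$ is obtained from $G\cup G'$ by adding all edges $v_iu_{\alpha(i)}$, $1\le i\le n$. An edge-coloring of a graph is an arbitrary map from its edge set to the natural numbers (adjacent edges may share a color). In an edge-colored graph, a path $P$ is a distance $\ell$-proper path if no two edges of $P$ of the same color appear with fewer than $\ell$ edges in between on $P$. For a connected graph $F$, $pc_{1,\ell}(F)$ is the minimum number of colors in an edge-coloring of $F$ such that every pair of distinct vertices of $F$ is connected by at least one distance $\ell$-proper path. -}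

module Defs where

open import Data.Fin using (Fin; zero; suc; toℕ; fromℕ; inject₁; _≟_) renaming (_<_ to _<ᶠ_)
open import Data.Fin.Permutation using (Permutation′; _⟨$⟩ʳ_)
open import Data.List using (List; length)
open import Data.List.Membership.Propositional using (_∈_)
open import Data.List.Relation.Unary.Unique.Propositional using (Unique)
open import Data.Nat using (ℕ; suc; _≤_; _∸_)
open import Data.Product using (Σ; ∃; ∃₂; _×_; _,_)
open import Data.Sum using (_⊎_; inj₁; inj₂)
open import Function.Bundles using (_⇔_)
open import Function.Definitions using (Injective)
open import Level using (0ℓ)
open import Relation.Binary using (Rel; Symmetric; Irreflexive; Decidable)
open import Relation.Binary.PropositionalEquality using (_≡_; _≢_; refl)

-- Adjacency is required to be decidable, as it is for any finite graph
-- classically. Finiteness comes from the vertex type, which is always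
-- Fin n or Fin n ⊎ Fin n below.
record Graph (V : Set) : Set₁ where
  field
    Adj        : Rel V 0ℓ
    adj-sym    : Symmetric Adj
    adj-irrefl : Irreflexive _≡_ Adj
    adj?       : Decidable Adj

module _ {V : Set} (G : Graph V) where
  open Graph G

  -- A path with `size` edges; its i-th edge joins vertex (inject₁ i) to
  -- vertex (suc i).
  record Path (u v : V) : Set where
    field
      size     : ℕ
      vertex   : Fin (suc size) → V
      distinct : Injective _≡_ _≡_ vertex
      adjacent : ∀ (i : Fin size) → Adj (vertex (inject₁ i)) (vertex (suc i))
      start    : vertex zero ≡ u
      end      : vertex (fromℕ size) ≡ v

  IsHamiltonian : ∀ {u v} → Path u v → Set
  IsHamiltonian p = ∀ w → ∃ λ i → Path.vertex p i ≡ w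

  Traceable : Set
  Traceable = ∃₂ λ u v → Σ (Path u v) IsHamiltonian

  -- A map from the (undirected) edges to ℕ: the values of `colour` on
  -- non-adjacent pairs are arbitrary and are never used.
  record EdgeColouring : Set where
    field
      colour     : V → V → ℕ
      colour-sym : ∀ {u v} → Adj u v → colour u v ≡ colour v u

  module _ (c : EdgeColouring) where
    open EdgeColouring c

    -- k is the cardinality of the image of the edge set; `cs` lists that
    -- image without repetition.
    UsesColours : ℕ → Set
    UsesColours k =
      ∃ λ (cs : List ℕ) → Unique cs × length cs ≡ k ×
        (∀ m → m ∈ cs ⇔ (∃₂ λ u v → Adj u v × colour u v ≡ m))

    edgeColour : ∀ {u v} (p : Path u v) → Fin (Path.size p) → ℕ
    edgeColour p i = colour (Path.vertex p (inject₁ i)) (Path.vertex p (suc i))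

    -- For i < j there are j ∸ suc i edges strictly between edges i and j.
    DistanceProper : ℕ → ∀ {u v} → Path u v → Set
    DistanceProper ℓ p = ∀ {i j} → i <ᶠ j → edgeColour p i ≡ edgeColour p j →
      ℓ ≤ toℕ j ∸ suc (toℕ i)

    DistanceProperConnected : ℕ → Set
    DistanceProperConnected ℓ = ∀ u v → u ≢ v → Σ (Path u v) (DistanceProper ℓ)

  HasConnectingColouring : ℕ → ℕ → Set
  HasConnectingColouring ℓ k =
    ∃ λ c → DistanceProperConnected c ℓ × UsesColours c k

  -- IsPC ℓ k says that pc_{1,ℓ} of the graph exists and equals k.
  IsPC : ℕ → ℕ → Set
  IsPC ℓ k = HasConnectingColouring ℓ k ×
    (∀ k′ → HasConnectingColouring ℓ k′ → k ≤ k′)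

-- inj₁ i is v_i and inj₂ i is u_i.
permutationGraph : ∀ {n} → Permutation′ n → Graph (Fin n) → Graph (Fin n ⊎ Fin n)
permutationGraph {n} α G = record
  { Adj = Adj′ ; adj-sym = λ {x} {y} → sym′ x y
  ; adj-irrefl = λ {x} {y} → irrefl′ x y ; adj? = dec′ }
  where
  open Graph G
  open import Data.Empty using (⊥)
  open import Relation.Nullary using (Dec)

  Adj′ : Rel (Fin n ⊎ Fin n) 0ℓ
  Adj′ (inj₁ i) (inj₁ j) = Adj i j
  Adj′ (inj₂ i) (inj₂ j) = Adj i j
  Adj′ (inj₁ i) (inj₂ j) = j ≡ α ⟨$⟩ʳ i
  Adj′ (inj₂ j) (inj₁ i) = j ≡ α ⟨$⟩ʳ i

  sym′ : ∀ x y → Adj′ x y → Adj′ y x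
  sym′ (inj₁ _) (inj₁ _) e = adj-sym e
  sym′ (inj₂ _) (inj₂ _) e = adj-sym e
  sym′ (inj₁ _) (inj₂ _) e = e
  sym′ (inj₂ _) (inj₁ _) e = e

  irrefl′ : ∀ x y → x ≡ y → Adj′ x y → ⊥
  irrefl′ (inj₁ _) (inj₁ _) refl e = adj-irrefl refl e
  irrefl′ (inj₂ _) (inj₂ _) refl e = adj-irrefl refl e

  dec′ : ∀ x y → Dec (Adj′ x y)
  dec′ (inj₁ i) (inj₁ j) = adj? i j
  dec′ (inj₂ i) (inj₂ j) = adj? i j
  dec′ (inj₁ i) (inj₂ j) = j ≟ (α ⟨$⟩ʳ i)
  dec′ (inj₂ j) (inj₁ i) = j ≟ (α ⟨$⟩ʳ i)

{-# OPTIONS --safe #-}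
module Submission where

-- Let v₀, …, vₙ₋₁ and u₀, …, uₙ₋₁ be the two copies of a Hamiltonian path,
-- let u_m and u_k be the partners of v₀ and vₙ₋₁, and assume m < k (otherwise
-- number the u's backwards).  The path u₀ … u_m v₀ … vₙ₋₁ u_k … uₙ₋₁ misses
-- only the middle vertices u_{m+1}, …, u_{k-1}.  Number the vertices along it
-- by consecutive levels, continue downwards from u_m through the middle, and
-- colour an edge between consecutive levels by the lower one modulo ℓ + 1.
-- Then u_{k-1} … u_m v₀ … vₙ₋₁ u_k … uₙ₋₁ is also coloured periodically, and
-- only the pairs of a left vertex uᵢ (i < m) and a middle vertex uⱼ remain.
-- For these, colour every other matching edge by its larger level, that is,
-- by its v-end: uᵢ … u_m v₀ … v_b uⱼ, with v_b the partner of uⱼ, is periodic.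
--
-- Attainment of the minimum pc is constructive because, for each bound on the
-- colours, the existence of a connecting colouring is decided by a finite search.

open import Data.Bool using (if_then_else_)
open import Data.Empty using (⊥)
open import Data.Fin using (Fin; zero; suc; toℕ; fromℕ; fromℕ<; inject₁; opposite)
  renaming (_<_ to _<ᶠ_; _<?_ to _<ᶠ?_)
import Data.Fin as Fin
open import Data.Fin.Permutation using (Permutation′; _⟨$⟩ʳ_; _⟨$⟩ˡ_; inverseʳ; inverseˡ)
open import Data.Fin.Properties using
  ( any?; all?; injective⇒≤; toℕ-fromℕ<; toℕ<n; toℕ-injective; toℕ-inject₁
  ; opposite-prop; opposite-involutive; +↔⊎ )
open import Data.List using (List; []; _∷_; length; filter; upTo)
open import Data.List.Membership.Propositional using (_∈_)
open import Data.List.Membership.Propositional.Properties using (∈-filter⁺; ∈-filter⁻; ∈-upTo⁺)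
open import Data.List.Properties using (length-filter; length-upTo)
open import Data.List.Relation.Unary.Any using (here; there)
open import Data.List.Relation.Unary.Unique.Propositional.Properties using (upTo⁺; filter⁺)
open import Data.Nat hiding (_≟_)
open import Data.Nat.DivMod using (m≡m%n+[m/n]*n; m%n<n)
open import Data.Nat.Properties hiding (_≟_)
import Data.Nat.Properties as ℕ
open import Data.Product using (Σ; ∃; ∃₂; _×_; _,_; proj₁; proj₂; map₂)
open import Data.Sum using (_⊎_; inj₁; inj₂; [_,_]′)
import Data.Vec.Functional as Vector
open import Function using (_∘_; flip; id)
open import Function.Bundles using (_↔_; Inverse; mk⇔; Equivalence)
open import Function.Properties.Inverse using (↔-sym)
open import Level using (0ℓ)
open import Relation.Binary using (Rel; Reflexive; Transitive; DecidableEquality; _Respects_)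
open import Relation.Binary.Construct.Closure.ReflexiveTransitive using (Star; ε; _◅_; _◅◅_)
open import Relation.Binary.PropositionalEquality
open import Relation.Nullary using (Dec; yes; no; ¬_; contradiction; does)
open import Relation.Nullary.Decidable using (map′; _×-dec_; _→-dec_; ¬?; dec-true; dec-false)
open import Relation.Unary using (Pred; Decidable)
open import Defs

-- Least witnesses and exhaustive search.

least : {P : Pred ℕ 0ℓ} → Decidable P → ∀ {m} → P m →
  ∃ λ k → P k × k ≤ m × (∀ j → P j → k ≤ j)
least P? {m} pm with P? 0
... | yes p0 = 0 , p0 , z≤n , λ _ _ → z≤n
least P? {zero}  pm | no ¬p0 = contradiction pm ¬p0
least P? {suc m} pm | no ¬p0 with k , pk , k≤m , min ← least (P? ∘ suc) pm =
  suc k , pk , s≤s k≤m , λ { zero p0 → contradiction p0 ¬p0 ; (suc j) pj → s≤s (min j pj) }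

-- Without function extensionality, function spaces can be searched only
-- for predicates that respect pointwise equality.
Searchable : (A : Set) → Rel A 0ℓ → Set₁
Searchable A _≈_ = {P : Pred A 0ℓ} → P Respects _≈_ → Decidable P → Dec (∃ P)

searchable-Fin : ∀ {n} → Searchable (Fin n) _≡_
searchable-Fin _ = any?

Pointwise : ∀ {A B : Set} → Rel A 0ℓ → Rel (B → A) 0ℓ
Pointwise _≈_ f g = ∀ i → f i ≈ g i

module _ {A : Set} {_≈_ : Rel A 0ℓ} (≈-refl : Reflexive _≈_) (search : Searchable A _≈_) where

  -- Search over the first value, then recursively over the others. A function agrees with its head
  -- and tail only pointwise, which is where `resp` enters.
  searchable-Fin→ : ∀ n → Searchable (Fin n → A) (Pointwise _≈_)
  searchable-Fin→ zero resp P? with P? (λ ())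
  ... | yes p = yes (_ , p)
  ... | no ¬p = no λ (f , pf) → ¬p (resp (λ ()) pf)
  searchable-Fin→ (suc n) resp P? = map′
    (λ (a , f , p) → a Vector.∷ f , p)
    (λ (f , p) → Vector.head f , Vector.tail f , resp (λ { zero → ≈-refl ; (suc _) → ≈-refl }) p)
    (search (λ a≈b (f , p) → f , resp (λ { zero → a≈b ; (suc _) → ≈-refl }) p)
      λ a → searchable-Fin→ n
        (λ f≈g → resp λ { zero → ≈-refl ; (suc i) → f≈g i }) (P? ∘ (a Vector.∷_)))

module Finite {V : Set} {N : ℕ} (fin : V ↔ Fin N) where
  open Inverse fin using (to; from; strictlyInverseʳ)

  to-injective : ∀ {u v} → to u ≡ to v → u ≡ v
  to-injective eq = trans (sym (strictlyInverseʳ _)) (trans (cong from eq) (strictlyInverseʳ _))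

  _≟_ : DecidableEquality V
  u ≟ v = map′ to-injective (cong to) (to u Fin.≟ to v)

  exists? : {P : Pred V 0ℓ} → Decidable P → Dec (∃ P)
  exists? {P} P? = map′ (λ (i , p) → from i , p)
    (λ (v , p) → to v , subst P (sym (strictlyInverseʳ v)) p) (any? (P? ∘ from))

  forall? : {P : Pred V 0ℓ} → Decidable P → Dec (∀ v → P v)
  forall? {P} P? = map′ (λ p v → subst P (strictlyInverseʳ v) (p (to v))) (_∘ from) (all? (P? ∘ from))

  searchable-→ : {A : Set} {_≈_ : Rel A 0ℓ} (≈-refl : Reflexive _≈_) (search : Searchable A _≈_) →
    Searchable (V → A) (Pointwise _≈_)
  searchable-→ {_≈_ = _≈_} ≈-refl search resp P? = map′
    (λ (f , p) → f ∘ to , p)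
    (λ (f , p) → f ∘ from , resp (λ v → subst (λ w → f v ≈ f w) (sym (strictlyInverseʳ v)) ≈-refl) p)
    (searchable-Fin→ ≈-refl search N (λ f≈g → resp (f≈g ∘ to)) (P? ∘ (_∘ to)))

-- Bounding the colours instead of counting them.

module _ {V : Set} (F : Graph V) where
  open Graph F
  open EdgeColouring

  Bounded : EdgeColouring F → ℕ → Set
  Bounded c k = ∀ u v → Adj u v → colour c u v < k

  HasBoundedColouring : ℕ → ℕ → Set
  HasBoundedColouring ℓ k = ∃ λ c → DistanceProperConnected F c ℓ × Bounded c k

  -- Only equal colours impose a constraint, so if `c′` creates no new coincidences between edges,
  -- the same paths stay proper.
  recolour : ∀ {c c′ : EdgeColouring F} {ℓ} →
    (∀ {a b a′ b′} → Adj a b → Adj a′ b′ →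
      colour c′ a b ≡ colour c′ a′ b′ → colour c a b ≡ colour c a′ b′) →
    DistanceProperConnected F c ℓ → DistanceProperConnected F c′ ℓ
  recolour reflects connect u v u≢v with p , proper ← connect u v u≢v =
    p , λ {i} {j} i<j eq → proper i<j (reflects (Path.adjacent p i) (Path.adjacent p j) eq)

-- Compresses the used colours to an initial segment of ℕ; a value absent from the list gets its
-- length.
firstIndex : List ℕ → ℕ → ℕ
firstIndex []       m = 0
firstIndex (x ∷ xs) m with x ℕ.≟ m
... | yes _ = 0
... | no  _ = suc (firstIndex xs m)

firstIndex-< : ∀ {m xs} → m ∈ xs → firstIndex xs m < length xs
firstIndex-< {m} {x ∷ xs} m∈ with x ℕ.≟ m | m∈
... | yes _  | _          = s≤s z≤n
... | no x≢m | here refl  = contradiction refl x≢m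
... | no _   | there m∈xs = s≤s (firstIndex-< m∈xs)

firstIndex-injective : ∀ {m m′ xs} → m ∈ xs → m′ ∈ xs →
  firstIndex xs m ≡ firstIndex xs m′ → m ≡ m′
firstIndex-injective {m} {m′} {x ∷ xs} m∈ m′∈ eq with x ℕ.≟ m | x ℕ.≟ m′ | m∈ | m′∈
... | yes refl | yes refl | _ | _ = refl
... | no x≢m | no _ | here refl | _ = contradiction refl x≢m
... | no _ | no x≢m′ | there _ | here refl = contradiction refl x≢m′
... | no _ | no _ | there m∈xs | there m′∈xs = firstIndex-injective m∈xs m′∈xs (suc-injective eq)

module _ {V : Set} {N : ℕ} (fin : V ↔ Fin N) (F : Graph V) where
  open Finite fin
  open Graph F
  open EdgeColouring

  connecting⇒bounded : ∀ {ℓ k} → HasConnectingColouring F ℓ k → HasBoundedColouring F ℓ k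
  connecting⇒bounded (c , connect , cs , _ , refl , image) = c′ , connect′ , bounded
    where
    ∈cs : ∀ {u v} → Adj u v → colour c u v ∈ cs
    ∈cs e = Equivalence.from (image _) (_ , _ , e , refl)

    c′ : EdgeColouring F
    c′ = record
      { colour     = λ u v → firstIndex cs (colour c u v)
      ; colour-sym = cong (firstIndex cs) ∘ colour-sym c }

    connect′ : DistanceProperConnected F c′ _
    connect′ = recolour F {c} {c′} (λ e e′ → firstIndex-injective (∈cs e) (∈cs e′)) connect

    bounded : Bounded F c′ (length cs)
    bounded u v e = firstIndex-< (∈cs e)

  -- Some values below `k` may occur on no edge, hence only an inequality; the used ones are
  -- filtered out by searching all pairs of vertices.
  bounded⇒connecting : ∀ {ℓ k} → HasBoundedColouring F ℓ k →
    ∃ λ k′ → HasConnectingColouring F ℓ k′ × k′ ≤ k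
  bounded⇒connecting {k = k} (c , connect , bounded) =
    length cs , (c , connect , cs , filter⁺ used? (upTo⁺ k) , refl , image) ,
    subst (length cs ≤_) (length-upTo k) (length-filter used? (upTo k))
    where
    Used : Pred ℕ 0ℓ
    Used m = ∃₂ λ u v → Adj u v × colour c u v ≡ m

    used? : Decidable Used
    used? m = exists? λ u → exists? λ v → adj? u v ×-dec (colour c u v ℕ.≟ m)

    cs = filter used? (upTo k)

    image = λ m → mk⇔ (λ m∈ → proj₂ (∈-filter⁻ used? {xs = upTo k} m∈))
      λ { (u , v , e , refl) → ∈-filter⁺ used? (∈-upTo⁺ (bounded u v e)) (u , v , e , refl) }

  module _ (c : EdgeColouring F) (ℓ : ℕ) (u v : V) where

    IsProperPath : (s : ℕ) → Pred (Fin (suc s) → V) 0ℓ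
    IsProperPath s f =
      (∀ i j → f i ≡ f j → i ≡ j) ×
      (∀ i → Adj (f (inject₁ i)) (f (suc i))) ×
      (f zero ≡ u) × (f (fromℕ s) ≡ v) ×
      (∀ i j → i <ᶠ j →
        colour c (f (inject₁ i)) (f (suc i)) ≡ colour c (f (inject₁ j)) (f (suc j)) →
        ℓ ≤ toℕ j ∸ suc (toℕ i))

    isProperPath? : ∀ s → Decidable (IsProperPath s)
    isProperPath? s f =
      all? (λ i → all? λ j → (f i ≟ f j) →-dec (i Fin.≟ j)) ×-dec
      all? (λ i → adj? _ _) ×-dec
      (f zero ≟ u) ×-dec (f (fromℕ s) ≟ v) ×-dec
      all? (λ i → all? λ j → (i <ᶠ? j) →-dec ((_ ℕ.≟ _) →-dec (_ ≤? _)))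

    isProperPath-resp : ∀ s → IsProperPath s Respects Pointwise _≡_
    isProperPath-resp s f≗g (distinct , adjacent , start , end , proper) =
      (λ i j eq → distinct i j (trans (f≗g i) (trans eq (sym (f≗g j))))) ,
      (λ i → subst₂ Adj (f≗g _) (f≗g _) (adjacent i)) ,
      trans (sym (f≗g _)) start , trans (sym (f≗g _)) end ,
      λ i j i<j eq → proper i j i<j
        (trans (cong₂ (colour c) (f≗g _) (f≗g _)) (trans eq (sym (cong₂ (colour c) (f≗g _) (f≗g _)))))

    -- The distinct vertices of a path embed in `Fin N`, so only sizes below `N` have to be
    -- searched.
    properPath? : Dec (Σ (Path F u v) (DistanceProper F c ℓ))
    properPath? = map′
      (λ (s , f , distinct , adjacent , start , end , proper) →
        record { size = toℕ s ; vertex = f ; distinct = distinct _ _ ; adjacent = adjacent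
               ; start = start ; end = end } , proper _ _)
      toWitness
      (any? λ s → searchable-→Fin (suc (toℕ s)) (isProperPath-resp (toℕ s)) (isProperPath? (toℕ s)))
      where
      searchable-→Fin : ∀ n → Searchable (Fin n → V) (Pointwise _≡_)
      searchable-→Fin = searchable-Fin→ {_≈_ = _≡_} refl (λ _ → exists?)

      toWitness : Σ (Path F u v) (DistanceProper F c ℓ) →
        ∃ λ (s : Fin N) → ∃ (IsProperPath (toℕ s))
      toWitness (p , proper) = fromℕ< size<N ,
        subst (∃ ∘ IsProperPath) (sym (toℕ-fromℕ< size<N))
          (vertex , (λ _ _ → distinct) , adjacent , start , end , λ _ _ → proper)
        where
        open Path p
        size<N : size < N
        size<N = injective⇒≤ (distinct ∘ to-injective)

  -- Every colouring with values at most k comes, on the edges, from an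
  -- arbitrary map V → V → Fin (suc k) by taking the maximum over both
  -- orientations.
  symmetrise : ∀ {k} → (V → V → Fin (suc k)) → EdgeColouring F
  symmetrise f = record
    { colour     = λ u v → toℕ (f u v) ⊔ toℕ (f v u)
    ; colour-sym = λ {u} {v} _ → ⊔-comm (toℕ (f u v)) (toℕ (f v u)) }

  hasBoundedColouring? : ∀ ℓ k → Dec (HasBoundedColouring F ℓ k)
  hasBoundedColouring? ℓ k = map′ (λ (f , good) → symmetrise f , good) toWitness
    (searchable-→ (λ _ → refl) (searchable-→ refl searchable-Fin) good-resp good?)
    where
    Good : Pred (V → V → Fin (suc k)) 0ℓ
    Good f = DistanceProperConnected F (symmetrise f) ℓ × Bounded F (symmetrise f) k

    good? : Decidable Good
    good? f =
      forall? (λ u → forall? λ v → ¬? (u ≟ v) →-dec properPath? (symmetrise f) ℓ u v) ×-dec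
      forall? (λ u → forall? λ v → adj? u v →-dec (_ <? _))

    good-resp : Good Respects Pointwise (Pointwise _≡_)
    good-resp {f} {g} f≗g (connect , bounded) =
      recolour F {symmetrise f} {symmetrise g} (λ _ _ eq → trans (same _ _) (trans eq (sym (same _ _)))) connect ,
      λ u v e → subst (_< k) (same u v) (bounded u v e)
      where
      same : ∀ u v → colour (symmetrise f) u v ≡ colour (symmetrise g) u v
      same u v = cong₂ (λ x y → toℕ x ⊔ toℕ y) (f≗g u v) (f≗g v u)

    toWitness : HasBoundedColouring F ℓ k → ∃ Good
    toWitness (c , connect , bounded) = f ,
      recolour F {c} {symmetrise f} (λ e e′ eq → trans (sym (same e)) (trans eq (same e′))) connect ,
      λ u v e → subst (_< k) (sym (same e)) (bounded u v e)
      where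
      -- Values on non-edges are unrestricted and are clamped to `k`; on edges the clamp changes
      -- nothing.
      f : V → V → Fin (suc k)
      f u v = fromℕ< (s≤s (m⊓n≤n (colour c u v) k))

      toℕ-f : ∀ {u v} → Adj u v → toℕ (f u v) ≡ colour c u v
      toℕ-f e = trans (toℕ-fromℕ< _) (m≤n⇒m⊓n≡m (<⇒≤ (bounded _ _ e)))

      same : ∀ {u v} → Adj u v → colour (symmetrise f) u v ≡ colour c u v
      same e = trans (cong₂ _⊔_ (toℕ-f e) (trans (toℕ-f (adj-sym e)) (sym (colour-sym c e)))) (⊔-idem _)

  -- A colouring for the least bound `k₀` uses `k₁ ≤ k₀` colours. Conversely, every attainable
  -- number of colours is a bound after renumbering, hence at least `k₀`.
  bounded⇒isPC : ∀ {ℓ k} → HasBoundedColouring F ℓ k → ∃ λ k′ → IsPC F ℓ k′ × k′ ≤ k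
  bounded⇒isPC {ℓ} bounded
    with k₀ , bounded₀ , k₀≤k , min ← least (hasBoundedColouring? ℓ) bounded
    with k₁ , connecting , k₁≤k₀ ← bounded⇒connecting bounded₀ =
    k₁ , (connecting , λ j h → ≤-trans k₁≤k₀ (min j (connecting⇒bounded h))) , ≤-trans k₁≤k₀ k₀≤k

-- Residues, reversed paths and periodic runs.

congruent-gap : ∀ {a b} c .{{_ : NonZero c}} → a < b → a % c ≡ b % c → a + c ≤ b
congruent-gap {a} {b} c a<b eq = begin
  a + c                        ≡⟨ cong (_+ c) (m≡m%n+[m/n]*n a c) ⟩
  a % c + (a / c) * c + c      ≡⟨ +-assoc (a % c) _ c ⟩
  a % c + ((a / c) * c + c)    ≡⟨ cong₂ _+_ eq (+-comm _ c) ⟩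
  b % c + suc (a / c) * c      ≤⟨ +-monoʳ-≤ (b % c) (*-monoˡ-≤ c quotient<) ⟩
  b % c + (b / c) * c          ≡⟨ m≡m%n+[m/n]*n b c ⟨
  b                            ∎
  where
  open ≤-Reasoning
  quotient< : a / c < b / c
  quotient< = ≰⇒> λ b/c≤a/c → <⇒≱ a<b (begin
    b                     ≡⟨ m≡m%n+[m/n]*n b c ⟩
    b % c + (b / c) * c   ≤⟨ +-mono-≤ (≤-reflexive (sym eq)) (*-monoˡ-≤ c b/c≤a/c) ⟩
    a % c + (a / c) * c   ≡⟨ m≡m%n+[m/n]*n a c ⟨
    a                     ∎)

opposite-inject₁ : ∀ {n} (i : Fin n) → opposite (inject₁ i) ≡ suc (opposite i)
opposite-inject₁ zero    = refl
opposite-inject₁ (suc i) = cong inject₁ (opposite-inject₁ i)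

opposite-fromℕ : ∀ n → opposite (fromℕ n) ≡ zero
opposite-fromℕ zero    = refl
opposite-fromℕ (suc n) = cong inject₁ (opposite-fromℕ n)

opposite-injective : ∀ {n} {i j : Fin n} → opposite i ≡ opposite j → i ≡ j
opposite-injective eq =
  trans (sym (opposite-involutive _)) (trans (cong opposite eq) (opposite-involutive _))

module _ {V : Set} (F : Graph V) (c : EdgeColouring F) (ℓ : ℕ) where
  open Graph F
  open EdgeColouring c

  ProperlyLinked : Rel V 0ℓ
  ProperlyLinked u v = Σ (Path F u v) (DistanceProper F c ℓ)

  -- Reversal preserves the number of edges between two edges, so each pair can be joined in
  -- whichever direction is convenient.
  linked-sym : ∀ {u v} → ProperlyLinked u v → ProperlyLinked v u
  linked-sym (p , proper) = reversed , λ {i} {j} → reversed-proper i j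
    where
    open Path p

    adjacent′ : ∀ i → Adj (vertex (opposite (inject₁ i))) (vertex (opposite (suc i)))
    adjacent′ i = subst (λ j → Adj (vertex j) (vertex (opposite (suc i))))
      (sym (opposite-inject₁ i)) (adj-sym (adjacent (opposite i)))

    reversed : Path F _ _
    reversed = record
      { size     = size
      ; vertex   = vertex ∘ opposite
      ; distinct = λ eq → opposite-injective (distinct eq)
      ; adjacent = adjacent′
      ; start    = end
      ; end      = trans (cong vertex (opposite-fromℕ size)) start }

    colour-reversed : ∀ i → edgeColour F c reversed i ≡ edgeColour F c p (opposite i)
    colour-reversed i = trans (colour-sym (adjacent′ i))
      (cong (colour (vertex (opposite (suc i))) ∘ vertex) (opposite-inject₁ i))

    reversed-proper : ∀ i j → i <ᶠ j → edgeColour F c reversed i ≡ edgeColour F c reversed j →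
      ℓ ≤ toℕ j ∸ suc (toℕ i)
    reversed-proper i j i<j eq = subst (ℓ ≤_) distance (proper opposite-<
      (trans (sym (colour-reversed j)) (trans (sym eq) (colour-reversed i))))
      where
      opposite-< : opposite j <ᶠ opposite i
      opposite-< = subst₂ _<_ (sym (opposite-prop j)) (sym (opposite-prop i))
        (∸-monoʳ-< (s≤s i<j) (toℕ<n j))

      -- Exchanging the two subtrahends produces `size ∸ (size ∸ toℕ j)`, which collapses because
      -- `j` is in range.
      distance : toℕ (opposite i) ∸ suc (toℕ (opposite j)) ≡ toℕ j ∸ suc (toℕ i)
      distance = begin
        toℕ (opposite i) ∸ suc (toℕ (opposite j))
          ≡⟨ cong₂ (λ x y → x ∸ suc y) (opposite-prop i) (opposite-prop j) ⟩
        size ∸ suc (toℕ i) ∸ suc (size ∸ suc (toℕ j))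
          ≡⟨ ∸-+-assoc size (suc (toℕ i)) _ ⟩
        size ∸ (suc (toℕ i) + suc (size ∸ suc (toℕ j)))
          ≡⟨ cong (size ∸_) (+-comm (suc (toℕ i)) _) ⟩
        size ∸ (suc (size ∸ suc (toℕ j)) + suc (toℕ i))
          ≡⟨ ∸-+-assoc size (suc (size ∸ suc (toℕ j))) (suc (toℕ i)) ⟨
        size ∸ suc (size ∸ suc (toℕ j)) ∸ suc (toℕ i)
          ≡⟨ cong (λ x → size ∸ x ∸ suc (toℕ i)) (+-∸-assoc 1 (toℕ<n j)) ⟨
        size ∸ (size ∸ toℕ j) ∸ suc (toℕ i)
          ≡⟨ cong (_∸ suc (toℕ i)) (m∸[m∸n]≡n (<⇒≤ (toℕ<n j))) ⟩
        toℕ j ∸ suc (toℕ i) ∎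
        where open ≡-Reasoning

  -- A walk whose edges carry the colours s, s + 1, s + 2, … modulo ℓ + 1;
  -- the increasing rank ρ guarantees that it is a path.
  data Run (ρ : V → ℕ) : ℕ → V → V → Set where
    stop : ∀ {s v} → Run ρ s v v
    step : ∀ {s u v w} → Adj u v → colour u v ≡ s % suc ℓ → ρ u < ρ v →
      Run ρ (suc s) v w → Run ρ s u w

  module _ {ρ : V → ℕ} where
    runLength : ∀ {s u v} → Run ρ s u v → ℕ
    runLength stop           = 0
    runLength (step _ _ _ r) = suc (runLength r)

    runVertex : ∀ {s u v} (r : Run ρ s u v) → Fin (suc (runLength r)) → V
    runVertex {u = u} r      zero    = u
    runVertex (step _ _ _ r) (suc i) = runVertex r i

    runVertex-last : ∀ {s u v} (r : Run ρ s u v) → runVertex r (fromℕ (runLength r)) ≡ v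
    runVertex-last stop           = refl
    runVertex-last (step _ _ _ r) = runVertex-last r

    runVertex-adjacent : ∀ {s u v} (r : Run ρ s u v) i → Adj (runVertex r (inject₁ i)) (runVertex r (suc i))
    runVertex-adjacent (step e _ _ _) zero    = e
    runVertex-adjacent (step _ _ _ r) (suc i) = runVertex-adjacent r i

    runVertex-colour : ∀ {s u v} (r : Run ρ s u v) i →
      colour (runVertex r (inject₁ i)) (runVertex r (suc i)) ≡ (s + toℕ i) % suc ℓ
    runVertex-colour {s} (step _ eq _ _) zero    = trans eq (cong (_% suc ℓ) (sym (+-identityʳ s)))
    runVertex-colour {s} (step _ _ _ r)  (suc i) =
      trans (runVertex-colour r i) (cong (_% suc ℓ) (sym (+-suc s (toℕ i))))

    rank-≤ : ∀ {s u v} (r : Run ρ s u v) i → ρ u ≤ ρ (runVertex r i)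
    rank-≤ r               zero    = ≤-refl
    rank-≤ (step _ _ ρ< r) (suc i) = ≤-trans (<⇒≤ ρ<) (rank-≤ r i)

    runVertex-injective : ∀ {s u v} (r : Run ρ s u v) i j → runVertex r i ≡ runVertex r j → i ≡ j
    runVertex-injective r               zero    zero    eq = refl
    runVertex-injective (step _ _ ρ< r) zero    (suc j) eq =
      contradiction (cong ρ eq) (<⇒≢ (≤-trans ρ< (rank-≤ r j)))
    runVertex-injective (step _ _ ρ< r) (suc i) zero    eq =
      contradiction (cong ρ (sym eq)) (<⇒≢ (≤-trans ρ< (rank-≤ r i)))
    runVertex-injective (step _ _ _ r)  (suc i) (suc j) eq = cong suc (runVertex-injective r i j eq)

    -- Edges of equal colour have congruent positions, so these differ by at least `suc ℓ`, leaving
    -- `ℓ` edges in between.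
    run⇒linked : ∀ {s u v} → Run ρ s u v → ProperlyLinked u v
    run⇒linked {s} r = record
      { size     = runLength r
      ; vertex   = runVertex r
      ; distinct = runVertex-injective r _ _
      ; adjacent = runVertex-adjacent r
      ; start    = refl
      ; end      = runVertex-last r } , λ {i} {j} → proper i j
      where
      proper : ∀ i j → i <ᶠ j →
        colour (runVertex r (inject₁ i)) (runVertex r (suc i)) ≡
          colour (runVertex r (inject₁ j)) (runVertex r (suc j)) →
        ℓ ≤ toℕ j ∸ suc (toℕ i)
      proper i j i<j eq = m+n≤o⇒m≤o∸n ℓ (subst (_≤ toℕ j) i+1+ℓ≡ℓ+1+i (+-cancelˡ-≤ s _ _
        (subst (_≤ s + toℕ j) (+-assoc s (toℕ i) (suc ℓ))
          (congruent-gap (suc ℓ) (+-monoʳ-< s i<j)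
            (trans (sym (runVertex-colour r i)) (trans eq (runVertex-colour r j)))))))
        where
        i+1+ℓ≡ℓ+1+i : toℕ i + suc ℓ ≡ ℓ + suc (toℕ i)
        i+1+ℓ≡ℓ+1+i = trans (+-suc (toℕ i) ℓ) (trans (cong suc (+-comm (toℕ i) ℓ)) (sym (+-suc ℓ (toℕ i))))

-- Hamiltonian paths as numberings.

-- A Hamiltonian path of G; `at` is junk from index n on.
record HamiltonianOrder {n} (G : Graph (Fin n)) : Set where
  field
    at       : ℕ → Fin n
    pos      : Fin n → ℕ
    pos<n    : ∀ w → pos w < n
    at-pos   : ∀ w → at (pos w) ≡ w
    pos-at   : ∀ {i} → i < n → pos (at i) ≡ i
    adjacent : ∀ {i} → suc i < n → Graph.Adj G (at i) (at (suc i))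

hamiltonianOrder : ∀ {n} {G : Graph (Fin n)} → Traceable G → HamiltonianOrder G
hamiltonianOrder {n} {G} (u , v , p , ham) = record
  { at       = vertex ∘ clamp
  ; pos      = toℕ ∘ index
  ; pos<n    = λ w → subst (toℕ (index w) <_) 1+size≡n (toℕ<n (index w))
  ; at-pos   = λ w → trans (cong vertex (clamp-toℕ (index w))) (vertex-index w)
  ; pos-at   = λ i<n → trans (cong toℕ (distinct (vertex-index _))) (toℕ-clamp (<n⇒≤size i<n))
  ; adjacent = λ 1+i<n → next (<n⇒≤size 1+i<n) }
  where
  open Path p

  index : Fin n → Fin (suc size)
  index w = proj₁ (ham w)

  vertex-index : ∀ w → vertex (index w) ≡ w
  vertex-index w = proj₂ (ham w)

  index-injective : ∀ {w w′} → index w ≡ index w′ → w ≡ w′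
  index-injective eq = trans (sym (vertex-index _)) (trans (cong vertex eq) (vertex-index _))

  clamp : ℕ → Fin (suc size)
  clamp i = fromℕ< (s≤s (m⊓n≤n i size))

  toℕ-clamp : ∀ {i} → i ≤ size → toℕ (clamp i) ≡ i
  toℕ-clamp i≤s = trans (toℕ-fromℕ< _) (m≤n⇒m⊓n≡m i≤s)

  clamp-toℕ : ∀ i → clamp (toℕ i) ≡ i
  clamp-toℕ i = toℕ-injective (toℕ-clamp (s≤s⁻¹ (toℕ<n i)))

  -- Distinctness of the path's vertices gives one inequality, the Hamiltonian property the other.
  1+size≡n : suc size ≡ n
  1+size≡n = ≤-antisym (injective⇒≤ distinct) (injective⇒≤ index-injective)

  <n⇒≤size : ∀ {i} → i < n → i ≤ size
  <n⇒≤size {i} i<n = s≤s⁻¹ (subst (i <_) (sym 1+size≡n) i<n)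

  next : ∀ {i} → i < size → Graph.Adj G (vertex (clamp i)) (vertex (clamp (suc i)))
  next {i} i<size = subst₂ (λ a b → Graph.Adj G (vertex a) (vertex b))
    (toℕ-injective (trans (toℕ-inject₁ _) (trans (toℕ-fromℕ< i<size) (sym (toℕ-clamp (<⇒≤ i<size))))))
    (toℕ-injective (trans (cong suc (toℕ-fromℕ< i<size)) (sym (toℕ-clamp i<size))))
    (adjacent (fromℕ< i<size))

reverse : ∀ {n} {G : Graph (Fin (suc n))} → HamiltonianOrder G → HamiltonianOrder G
reverse {n} {G} σ = record
  { at       = λ i → at (n ∸ i)
  ; pos      = λ w → n ∸ pos w
  ; pos<n    = λ w → s≤s (m∸n≤m n (pos w))
  ; at-pos   = λ w → trans (cong at (m∸[m∸n]≡n (s≤s⁻¹ (pos<n w)))) (at-pos w)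
  ; pos-at   = λ {i} i<n → trans (cong (n ∸_) (pos-at (s≤s (m∸n≤m n i)))) (m∸[m∸n]≡n (s≤s⁻¹ i<n))
  ; adjacent = λ {i} i<n → let 1+[n∸1+i]≡n∸i = sym (+-∸-assoc 1 (s≤s⁻¹ i<n)) in
      Graph.adj-sym G (subst (λ j → Graph.Adj G (at (n ∸ suc i)) (at j)) 1+[n∸1+i]≡n∸i
        (adjacent (subst (_< suc n) (sym 1+[n∸1+i]≡n∸i) (s≤s (m∸n≤m n i))))) }
  where open HamiltonianOrder σ

-- Chains neighbours along a segment; the relation is arbitrary so that a flipped one can handle a
-- segment traversed downwards.
stepwise : ∀ {A : Set} {_∼_ : Rel A 0ℓ} → Reflexive _∼_ → Transitive _∼_ →
  (f : ℕ → A) {lo hi : ℕ} → (∀ {i} → lo ≤ i → i < hi → f i ∼ f (suc i)) →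
  ∀ {i j} → lo ≤ i → i ≤ j → j ≤ hi → f i ∼ f j
stepwise {_∼_ = _∼_} rfl trns f next lo≤i i≤j j≤hi = go lo≤i (≤⇒≤′ i≤j) j≤hi
  where
  go : ∀ {i j} → _ ≤ i → i ≤′ j → j ≤ _ → f i ∼ f j
  go lo≤i ≤′-refl j≤hi = rfl
  go lo≤i (≤′-step i≤′j) j<hi =
    trns (go lo≤i i≤′j (<⇒≤ j<hi)) (next (≤-trans lo≤i (≤′⇒≤ i≤′j)) j<hi)

-- Levels of edges and vertices.

-- The smaller of two consecutive levels, and the larger of two levels that
-- are further apart.
edgeLevel : ℕ → ℕ → ℕ
edgeLevel x y = (x ⊔ y) ∸ (2 ∸ ∣ x - y ∣)

edgeLevel-comm : ∀ x y → edgeLevel x y ≡ edgeLevel y x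
edgeLevel-comm x y = cong₂ (λ a b → a ∸ (2 ∸ b)) (⊔-comm x y) (∣-∣-comm x y)

edgeLevel-suc : ∀ x → edgeLevel x (suc x) ≡ x
edgeLevel-suc x = cong₂ (λ a b → a ∸ (2 ∸ b)) (m≤n⇒m⊔n≡n (n≤1+n x))
  (trans (m≤n⇒∣m-n∣≡n∸m (n≤1+n x)) (m+n∸n≡m 1 x))

-- At distance at least two the correction `2 ∸ ∣ x - y ∣` truncates to zero.
edgeLevel-far : ∀ {x y} → 2 + y ≤ x → edgeLevel x y ≡ x
edgeLevel-far {x} {y} 2+y≤x = cong₂ _∸_ (m≥n⇒m⊔n≡m y≤x)
  (m≤n⇒m∸n≡0 (subst (2 ≤_) (sym (trans (∣-∣-comm x y) (m≤n⇒∣m-n∣≡n∸m y≤x))) (m+n≤o⇒m≤o∸n 2 2+y≤x)))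
  where
  y≤x : y ≤ x
  y≤x = m+n≤o⇒n≤o 2 2+y≤x

-- The copies carry separate Hamiltonian orders, so that the second can be reversed alone to obtain
-- `m<k`.
module Construction {n′ : ℕ} {G : Graph (Fin (suc n′))} (α : Permutation′ (suc n′)) (ℓ : ℕ)
  (σ τ : HamiltonianOrder G)
  (m<k : HamiltonianOrder.pos τ (α ⟨$⟩ʳ HamiltonianOrder.at σ 0) <
         HamiltonianOrder.pos τ (α ⟨$⟩ʳ HamiltonianOrder.at σ n′)) where

  open HamiltonianOrder

  n = suc n′
  m = pos τ (α ⟨$⟩ʳ at σ 0)
  k = pos τ (α ⟨$⟩ʳ at σ n′)

  V = Fin n ⊎ Fin n

  P : Graph V
  P = permutationGraph α G

  open Graph P

  v u : ℕ → V
  v i = inj₁ (at σ i)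
  u i = inj₂ (at τ i)

  m<n : m < n
  m<n = pos<n τ _

  k<n : k < n
  k<n = pos<n τ _

  -- The offsets put u_m at level n, the v's at n+1, ..., 2n and u_k at 2n+1. Left and middle
  -- vertices both descend from u_m; positions differ by less than n, so the subtraction never
  -- truncates.
  uLevel : ℕ → ℕ
  uLevel i = if does (i <? k) then n ∸ ∣ i - m ∣ else suc n + n + (i ∸ k)

  level : V → ℕ
  level (inj₁ w) = suc n + pos σ w
  level (inj₂ w) = uLevel (pos τ w)

  level-v : ∀ {i} → i < n → level (v i) ≡ suc n + i
  level-v i<n = cong (suc n +_) (pos-at σ i<n)

  level-u-low : ∀ {i} → i < k → level (u i) ≡ n ∸ ∣ i - m ∣
  level-u-low {i} i<k rewrite pos-at τ (<-trans i<k k<n) | dec-true (i <? k) i<k = refl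

  level-u-left : ∀ {i} → i ≤ m → level (u i) ≡ n ∸ (m ∸ i)
  level-u-left i≤m = trans (level-u-low (≤-<-trans i≤m m<k)) (cong (n ∸_) (m≤n⇒∣m-n∣≡n∸m i≤m))

  level-u-middle : ∀ {i} → m ≤ i → i < k → level (u i) ≡ n ∸ (i ∸ m)
  level-u-middle {i} m≤i i<k =
    trans (level-u-low i<k) (cong (n ∸_) (trans (∣-∣-comm i m) (m≤n⇒∣m-n∣≡n∸m m≤i)))

  level-u-right : ∀ {i} → k ≤ i → i < n → level (u i) ≡ suc n + n + (i ∸ k)
  level-u-right {i} k≤i i<n rewrite pos-at τ i<n | dec-false (i <? k) (≤⇒≯ k≤i) = refl

  InMiddle : V → Set
  InMiddle (inj₁ _) = ⊥
  InMiddle (inj₂ w) = m < pos τ w × pos τ w < k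

  inMiddle? : ∀ w → Dec (InMiddle w)
  inMiddle? (inj₁ _) = no id
  inMiddle? (inj₂ w) = (m <? pos τ w) ×-dec (pos τ w <? k)

  -- The last component keeps a climb that starts outside the middle outside it, as `climb-rung⇒run`
  -- requires.
  Step : Rel V 0ℓ
  Step a b = Adj a b × level b ≡ suc (level a) × (InMiddle b → InMiddle a)

  _⇝_ : Rel V 0ℓ
  _⇝_ = Star Step

  ∸-suc : ∀ {a b} → b < a → suc (a ∸ suc b) ≡ a ∸ b
  ∸-suc b<a = sym (+-∸-assoc 1 b<a)

  v⇝v : ∀ {i j} → i ≤ j → j ≤ n′ → v i ⇝ v j
  v⇝v = stepwise {_∼_ = _⇝_} ε _◅◅_ v {0} next z≤n
    where
    next : ∀ {i} → 0 ≤ i → i < n′ → v i ⇝ v (suc i)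
    next {i} _ i<n′ = (adjacent σ (s≤s i<n′) ,
      trans (level-v (s≤s i<n′)) (trans (+-suc (suc n) i) (cong suc (sym (level-v (m<n⇒m<1+n i<n′))))) ,
      λ ()) ◅ ε

  left⇝left : ∀ {i j} → i ≤ j → j ≤ m → u i ⇝ u j
  left⇝left = stepwise {_∼_ = _⇝_} ε _◅◅_ u {0} next z≤n
    where
    next : ∀ {i} → 0 ≤ i → i < m → u i ⇝ u (suc i)
    next {i} _ i<m = (adjacent τ 1+i<n ,
      trans (level-u-left i<m) (trans (sym (∸-suc m∸[1+i]<n))
        (cong suc (trans (cong (n ∸_) (∸-suc i<m)) (sym (level-u-left (<⇒≤ i<m)))))) ,
      λ (m<1+i , _) → contradiction (subst (m <_) (pos-at τ 1+i<n) m<1+i) (≤⇒≯ i<m)) ◅ ε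
      where
      1+i<n : suc i < n
      1+i<n = ≤-<-trans i<m m<n
      m∸[1+i]<n : m ∸ suc i < n
      m∸[1+i]<n = ≤-<-trans (m∸n≤m m (suc i)) m<n

  middle⇝middle : ∀ {i j} → m ≤ i → i ≤ j → j < k → u j ⇝ u i
  -- Levels rise as the index falls towards `m`, hence the flipped relation; the bound `pred k`
  -- keeps `suc i` below `k`.
  middle⇝middle m≤i i≤j j<k = stepwise {_∼_ = flip _⇝_} ε (flip _◅◅_) u {m} {pred k} next m≤i i≤j (<⇒≤pred j<k)
    where
    next : ∀ {i} → m ≤ i → i < pred k → u (suc i) ⇝ u i
    next {i} m≤i i<k-1 = (Graph.adj-sym G (adjacent τ 1+i<n) ,
      trans (level-u-middle m≤i (<⇒≤ 1+i<k)) (trans (sym (∸-suc i∸m<n))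
        (cong suc (trans (cong (n ∸_) (sym (+-∸-assoc 1 m≤i))) (sym (level-u-middle (m≤n⇒m≤1+n m≤i) 1+i<k))))) ,
      λ _ → subst (λ x → m < x × x < k) (sym (pos-at τ 1+i<n)) (s≤s m≤i , 1+i<k)) ◅ ε
      where
      1+i<k : suc i < k
      1+i<k = m≤pred[n]⇒suc[m]≤n {{>-nonZero (≤-<-trans z≤n m<k)}} i<k-1
      1+i<n : suc i < n
      1+i<n = <-trans 1+i<k k<n
      i∸m<n : i ∸ m < n
      i∸m<n = ≤-<-trans (m∸n≤m i m) (<⇒≤ 1+i<n)

  right⇝right : ∀ {i j} → k ≤ i → i ≤ j → j ≤ n′ → u i ⇝ u j
  right⇝right = stepwise {_∼_ = _⇝_} ε _◅◅_ u {k} next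
    where
    next : ∀ {i} → k ≤ i → i < n′ → u i ⇝ u (suc i)
    next {i} k≤i i<n′ = (adjacent τ (s≤s i<n′) ,
      trans (level-u-right (m≤n⇒m≤1+n k≤i) (s≤s i<n′))
        (trans (cong (suc n + n +_) (+-∸-assoc 1 k≤i))
        (trans (+-suc (suc n + n) (i ∸ k)) (cong suc (sym (level-u-right k≤i (m<n⇒m<1+n i<n′)))))) ,
      λ (_ , 1+i<k) → contradiction (subst (_< k) (pos-at τ (s≤s i<n′)) 1+i<k) (≤⇒≯ (m≤n⇒m≤1+n k≤i))) ◅ ε

  -- This rung and `vₙ⇝uk` join consecutive levels, n to n+1 and 2n to 2n+1, so they are ordinary
  -- steps of a climb.
  um⇝v₀ : u m ⇝ v 0
  um⇝v₀ = (at-pos τ _ ,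
    trans (level-v (s≤s z≤n)) (trans (+-identityʳ (suc n))
      (cong suc (sym (trans (level-u-left ≤-refl) (cong (n ∸_) (n∸n≡0 m)))))) ,
    λ ()) ◅ ε

  vₙ⇝uk : v n′ ⇝ u k
  vₙ⇝uk = (at-pos τ _ ,
    trans (level-u-right ≤-refl k<n) (trans (cong (suc n + n +_) (n∸n≡0 k)) (trans (+-identityʳ _)
      (trans (+-suc (suc n) n′) (cong suc (sym (level-v ≤-refl)))))) ,
    λ (_ , k<k) → contradiction (subst (_< k) (pos-at τ k<n) k<k) (<-irrefl refl)) ◅ ε

  -- The colouring and its periodic paths.

  colouring : EdgeColouring P
  colouring = record
    { colour     = λ a b → edgeLevel (level a) (level b) % suc ℓ
    ; colour-sym = λ {a} {b} _ → cong (_% suc ℓ) (edgeLevel-comm (level a) (level b)) }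

  open EdgeColouring colouring

  Linked : Rel V 0ℓ
  Linked = ProperlyLinked P colouring ℓ

  step-colour : ∀ {a b} → Step a b → colour a b ≡ level a % suc ℓ
  step-colour {a} (_ , level-b , _) =
    cong (_% suc ℓ) (trans (cong (edgeLevel (level a)) level-b) (edgeLevel-suc (level a)))

  -- Each step raises the level by exactly one, so `level` serves both as colour index and as rank.
  climb⇒run : ∀ {a b} → a ⇝ b → Run P colouring ℓ level (level a) a b
  climb⇒run ε = stop
  climb⇒run {a} (s@(adj , level-b , _) ◅ climb) =
    step adj (step-colour s) (≤-reflexive (sym level-b))
      (subst (λ x → Run P colouring ℓ level x _ _) level-b (climb⇒run climb))

  climb⇒linked : ∀ {a b} → a ⇝ b → Linked a b
  climb⇒linked = run⇒linked P colouring ℓ ∘ climb⇒run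

  -- The levels of the left and middle parts of the u-path overlap; this rank
  -- separates them on paths ending in the middle.
  rank : V → ℕ
  rank a = if does (inMiddle? a) then suc n + n else level a

  rank-middle : ∀ {a} → InMiddle a → rank a ≡ suc n + n
  rank-middle {a} a∈ rewrite dec-true (inMiddle? a) a∈ = refl

  rank-other : ∀ {a} → ¬ InMiddle a → rank a ≡ level a
  rank-other {a} a∉ rewrite dec-false (inMiddle? a) a∉ = refl

  -- The final rung is coloured by the level of its v-end, which is the next index after the climb
  -- to that vertex; the colours stay periodic although the level drops.
  climb-rung⇒run : ∀ {a w b} → a ⇝ inj₁ w → ¬ InMiddle a → InMiddle b → Adj (inj₁ w) b →
    2 + level b ≤ level (inj₁ w) → Run P colouring ℓ rank (level a) a b
  climb-rung⇒run {w = w} {b} ε a∉ b∈ rung far =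
    step rung (cong (_% suc ℓ) (edgeLevel-far far))
      -- The rank 2n+1 of a middle vertex exceeds every v-level.
      (subst₂ _<_ (sym (rank-other {inj₁ w} a∉)) (sym (rank-middle {b} b∈)) (+-monoʳ-< (suc n) (pos<n σ w))) stop
  climb-rung⇒run {a} {w} {b} (_◅_ {j = a′} s@(adj , level-a′ , middle) climb) a∉ b∈ rung far =
    step adj (step-colour s)
      (subst₂ _<_ (sym (rank-other {a} a∉)) (sym (rank-other {a′} (a∉ ∘ middle))) (≤-reflexive (sym level-a′)))
      (subst (λ x → Run P colouring ℓ rank x a′ b) level-a′ (climb-rung⇒run climb (a∉ ∘ middle) b∈ rung far))

  -- Linking every pair of vertices.

  left⇝v : ∀ {i j} → i ≤ m → j ≤ n′ → u i ⇝ v j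
  left⇝v i≤m j≤n′ = left⇝left i≤m ≤-refl ◅◅ um⇝v₀ ◅◅ v⇝v z≤n j≤n′

  low⇝v : ∀ {i j} → i < k → j ≤ n′ → u i ⇝ v j
  low⇝v {i} i<k j≤n′ with ≤-total i m
  ... | inj₁ i≤m = left⇝v i≤m j≤n′
  ... | inj₂ m≤i = middle⇝middle ≤-refl m≤i i<k ◅◅ um⇝v₀ ◅◅ v⇝v z≤n j≤n′

  v⇝right : ∀ {i j} → i ≤ n′ → k ≤ j → j ≤ n′ → v i ⇝ u j
  v⇝right i≤n′ k≤j j≤n′ = v⇝v i≤n′ ≤-refl ◅◅ vₙ⇝uk ◅◅ right⇝right ≤-refl k≤j j≤n′

  left-middle : ∀ {i j} → i ≤ m → m < j → j < k → Linked (u i) (u j)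
  left-middle {i} {j} i≤m m<j j<k = run⇒linked P colouring ℓ
    (climb-rung⇒run (subst (λ w → u i ⇝ inj₁ w) (at-pos σ w) (left⇝v i≤m (s≤s⁻¹ (pos<n σ w))))
      (λ (m<i , _) → contradiction (subst (m <_) (pos-at τ (≤-<-trans i≤m m<n)) m<i) (≤⇒≯ i≤m))
      (subst (λ x → m < x × x < k) (sym (pos-at τ j<n)) (m<j , j<k))
      (sym (inverseʳ α))
      (≤-trans far (m≤m+n (suc n) (pos σ w))))
    where
    j<n : j < n
    j<n = <-trans j<k k<n

    w : Fin n
    w = α ⟨$⟩ˡ at τ j

    -- A middle vertex lies strictly below level n and the v-levels start at n+1, so the rung spans
    -- at least two levels.
    far : 2 + level (u j) ≤ suc n
    far = s≤s (subst (_< n) (sym (level-u-middle (<⇒≤ m<j) j<k))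
      (∸-monoʳ-< (m<n⇒0<n∸m m<j) (≤-trans (m∸n≤m j m) (<⇒≤ j<n))))

  -- Except for a left vertex with a middle one, some climb leads from one of the two vertices to
  -- the other; from below `k` to the right part it runs through the whole v-path.
  u-linked : ∀ {i j} → i ≤ j → j ≤ n′ → Linked (u i) (u j)
  u-linked {i} {j} i≤j j≤n′ with j ≤? m | i ≤? m | j <? k | i <? k
  ... | yes j≤m | _ | _ | _ = climb⇒linked (left⇝left i≤j j≤m)
  ... | no j≰m | yes i≤m | yes j<k | _ = left-middle i≤m (≰⇒> j≰m) j<k
  ... | _ | no i≰m | yes j<k | _ =
    linked-sym P colouring ℓ (climb⇒linked (middle⇝middle (≰⇒≥ i≰m) i≤j j<k))
  ... | _ | _ | no j≮k | yes i<k =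
    climb⇒linked (low⇝v i<k z≤n ◅◅ v⇝right z≤n (≮⇒≥ j≮k) j≤n′)
  ... | _ | _ | no _ | no i≮k = climb⇒linked (right⇝right (≮⇒≥ i≮k) i≤j j≤n′)

  v-u-linked : ∀ {i j} → i ≤ n′ → j ≤ n′ → Linked (v i) (u j)
  v-u-linked {i} {j} i≤n′ j≤n′ with j <? k
  ... | yes j<k = linked-sym P colouring ℓ (climb⇒linked (low⇝v j<k i≤n′))
  ... | no  j≮k = climb⇒linked (v⇝right i≤n′ (≮⇒≥ j≮k) j≤n′)

  linked : ∀ a b → Linked a b
  linked (inj₁ a) (inj₁ b) = subst₂ (λ x y → Linked (inj₁ x) (inj₁ y)) (at-pos σ a) (at-pos σ b)
    ([ (λ a≤b → climb⇒linked (v⇝v a≤b (s≤s⁻¹ (pos<n σ b))))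
     , (λ b≤a → linked-sym P colouring ℓ (climb⇒linked (v⇝v b≤a (s≤s⁻¹ (pos<n σ a))))) ]′
     (≤-total (pos σ a) (pos σ b)))
  linked (inj₁ a) (inj₂ b) = subst₂ (λ x y → Linked (inj₁ x) (inj₂ y)) (at-pos σ a) (at-pos τ b)
    (v-u-linked (s≤s⁻¹ (pos<n σ a)) (s≤s⁻¹ (pos<n τ b)))
  linked (inj₂ a) (inj₁ b) = linked-sym P colouring ℓ (linked (inj₁ b) (inj₂ a))
  linked (inj₂ a) (inj₂ b) = subst₂ (λ x y → Linked (inj₂ x) (inj₂ y)) (at-pos τ a) (at-pos τ b)
    ([ (λ a≤b → u-linked a≤b (s≤s⁻¹ (pos<n τ b)))
     , (λ b≤a → linked-sym P colouring ℓ (u-linked b≤a (s≤s⁻¹ (pos<n τ a)))) ]′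
     (≤-total (pos τ a) (pos τ b)))

  hasBoundedColouring : HasBoundedColouring P ℓ (suc ℓ)
  hasBoundedColouring = colouring , (λ a b _ → linked a b) ,
    λ a b _ → m%n<n (edgeLevel (level a) (level b)) (suc ℓ)

-- Choosing the direction of the second copy.

hasBoundedColouring : ∀ {n} {G : Graph (Fin n)} → 2 ≤ n → Traceable G → ∀ ℓ (α : Permutation′ n) →
  HasBoundedColouring (permutationGraph α G) ℓ (suc ℓ)
hasBoundedColouring {suc zero} (s≤s ()) _ _ _
hasBoundedColouring {suc (suc n)} {G} _ traceable ℓ α = [ forward , backward ]′ (≤-total m k)
  where
  σ : HamiltonianOrder G
  σ = hamiltonianOrder traceable

  open HamiltonianOrder σ

  m k : ℕ
  m = pos (α ⟨$⟩ʳ at 0)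
  k = pos (α ⟨$⟩ʳ at (suc n))

  -- With at least two vertices the ends of the Hamiltonian path differ, hence so do their partners
  -- under the injective `α`.
  m≢k : m ≢ k
  m≢k m≡k = 0≢1+n (begin
    0                 ≡⟨ pos-at (s≤s z≤n) ⟨
    pos (at 0)        ≡⟨ cong pos at₀≡atₙ ⟩
    pos (at (suc n))  ≡⟨ pos-at ≤-refl ⟩
    suc n             ∎)
    where
    open ≡-Reasoning
    at₀≡atₙ : at 0 ≡ at (suc n)
    at₀≡atₙ = trans (sym (inverseˡ α)) (trans (cong (α ⟨$⟩ˡ_)
      (trans (sym (at-pos _)) (trans (cong at m≡k) (at-pos _)))) (inverseˡ α))

  forward : m ≤ k → HasBoundedColouring (permutationGraph α G) ℓ (suc ℓ)
  forward m≤k = Construction.hasBoundedColouring α ℓ σ σ (≤∧≢⇒< m≤k m≢k)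

  backward : k ≤ m → HasBoundedColouring (permutationGraph α G) ℓ (suc ℓ)
  -- Reversing only the order of the second copy complements both positions and so swaps their
  -- order.
  backward k≤m = Construction.hasBoundedColouring α ℓ σ (reverse σ)
    (∸-monoʳ-< (≤∧≢⇒< k≤m (m≢k ∘ sym)) (s≤s⁻¹ (pos<n _)))

theorem4p3 : ∀ {n : ℕ} (G : Graph (Fin n)) → 2 ≤ n → Traceable G →
    ∀ (ℓ : ℕ) → 1 ≤ ℓ → ∀ (α : Permutation′ n) →
    ∃ λ k → IsPC (permutationGraph α G) ℓ k × k ≤ ℓ + 1
theorem4p3 G 2≤n traceable ℓ _ α =
  map₂ (map₂ λ k≤1+ℓ → ≤-trans k≤1+ℓ (≤-reflexive (+-comm 1 ℓ)))
    (bounded⇒isPC (↔-sym +↔⊎) (permutationGraph α G) (hasBoundedColouring 2≤n traceable ℓ α))
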